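{- Let $k,l\geq 1$ be integers. Then there exists a $(4kl^2+1,\,4k,\,l,\,1)$-$2$-CEDF in the cyclic group $\mathbb{Z}_{4kl^2+1}$.
   Context: For finite multisets/sets $A,B$ in an additive group, $\Delta(A,B)$ denotes the multiset $\{a-b : a\in A,\ b\in B\}$. Let $G$ be a group of order $n$, let $m>1$ and $1\le c\le m-1$. An ordered family $(A_0,\ldots,A_{m-1})$ of pairwise disjoint $l$-subsets of $G$ is an $(n,m,l,\lambda)$-$c$-CEDF (circular external difference family) if the multiset equation $\bigcup_{i=0}^{m-1}\Delta(A_{i+c \bmod m},A_i)=\lambda\,(G\setminus\{0\})$ holds, i.e. every nonzero element of $G$ occurs exactly $\lambda$ times in the multiset union and $0$ does not occur. -}

module Defs where

open import Data.Nat using (ℕ; zero; suc; _+_; _*_; _%_; NonZero; _≤_; _<_)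
open import Data.Nat.DivMod using (_mod_)
open import Data.Fin using (Fin; toℕ)
open import Data.Fin.Properties using (_≟_)
open import Data.List using (List; length; concatMap; map; filter; allFin)
open import Data.List.Relation.Unary.Unique.Propositional using (Unique)
open import Data.List.Membership.Propositional using (_∈_)
open import Relation.Nullary using (¬_)
open import Relation.Binary.PropositionalEquality using (_≡_; _≢_)
open import Data.Product using (_×_)

_⊖_ : ∀ {n} .{{_ : NonZero n}} → Fin n → Fin n → Fin n
_⊖_ {n} a b = (toℕ a + (n Data.Nat.∸ toℕ b)) mod n

Δ : ∀ {n} .{{_ : NonZero n}} → List (Fin n) → List (Fin n) → List (Fin n)
Δ A B = concatMap (λ a → map (λ b → a ⊖ b) B) A

_+ₘ_ : ∀ {m} → Fin m → ℕ → Fin m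
_+ₘ_ {zero} ()
_+ₘ_ {suc m} i c = (toℕ i + c) mod (suc m)

ΔUnion : ∀ {n m} .{{_ : NonZero n}} → ℕ → (Fin m → List (Fin n)) → List (Fin n)
ΔUnion {m = m} c A = concatMap (λ i → Δ (A (i +ₘ c)) (A i)) (allFin m)

mult : ∀ {n} → Fin n → List (Fin n) → ℕ
mult x xs = length (filter (x ≟_) xs)

-- (n,m,l,λ)-c-CEDF in ℤ_n: an ordered family (A_0,…,A_{m-1}) of pairwise
-- disjoint l-subsets of ℤ_n (subsets represented as duplicate-free lists)
-- with ⋃ Δ(A_{i+c}, A_i) = λ (ℤ_n ∖ {0}) as multisets.
record IsCEDF (n m l λ' c : ℕ) .{{_ : NonZero n}}
              (A : Fin m → List (Fin n)) : Set where
  field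
    m>1      : 1 Data.Nat.< m
    c≥1      : 1 ≤ c
    c≤m-1    : c < m
    unique   : ∀ i → Unique (A i)
    size     : ∀ i → length (A i) ≡ l
    disjoint : ∀ i j → i ≢ j → ∀ x → x ∈ A i → ¬ (x ∈ A j)
    zeroMult : ∀ (z : Fin n) → toℕ z ≡ 0 → mult z (ΔUnion c A) ≡ 0
    nonzeroMult : ∀ (g : Fin n) → ¬ (toℕ g ≡ 0) → mult g (ΔUnion c A) ≡ λ'

{-# OPTIONS --safe #-}
module Submission where

-- Write N = 4kl².  A low block f is {fl² + i : i < l} and a high block c is
-- {-(1 + cl² + jl) : j < l} in ℤ_{N+1}, so that the differences low - high are exactly
-- 1 + (f + c)l² + jl + i for i, j < l, one full block of l² consecutive values, and the differences
-- high - low are their negatives, i.e. the block numbered 4k - 1 - (f + c).  Under i ↦ i + 2 the index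
-- set is two cycles of length 2k, along which low and high blocks alternate.  It remains to number the
-- blocks so that every r < 4k is f + c for an edge high → low, or 4k - 1 - (f + c) for an edge low → high.
-- With t = ⌊k/2⌋ this is achieved by two zigzags: an outer one whose high numbers skip t, and an inner
-- one which uses t in the middle.  Since there are N differences in total, covering all N nonzero
-- elements forces each of them to occur exactly once and 0 not to occur.

open import Defs
open import Data.Nat hiding (parity; _≟_)
open import Data.Nat.Properties hiding (_≟_)
open import Data.Nat.DivMod
open import Data.Nat.Tactic.RingSolver using (solve-∀; solve)
open import Data.Product using (Σ; ∃; _×_; _,_; proj₁; proj₂)
open import Data.Sum using (_⊎_; inj₁; inj₂)
open import Data.Empty using (⊥-elim)
open import Data.Fin using (Fin; toℕ; fromℕ<; opposite) renaming (zero to fzero; suc to fsuc)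
open import Data.Fin.Properties
  using (_≟_; toℕ-fromℕ<; toℕ<n; toℕ-injective; opposite-prop; toℕ≤pred[n])
  renaming (suc-injective to fsuc-injective)
open import Data.List using (List; []; _∷_; _++_; length; map; concatMap; tabulate; allFin)
open import Data.List.Properties
  using (length-++; length-map; length-tabulate; filter-none; filter-accept; filter-reject)
open import Data.List.Relation.Unary.Any using (here; there)
import Data.List.Relation.Unary.All as All
open import Data.List.Relation.Unary.All.Properties using (¬Any⇒All¬; All¬⇒¬Any)
open import Data.List.Relation.Unary.AllPairs using ([]; _∷_)
open import Data.List.Relation.Unary.Unique.Propositional using (Unique)
open import Data.List.Relation.Unary.Unique.Propositional.Properties using (tabulate⁺)
open import Data.List.Membership.Propositional using (_∈_; _∉_; lose)
open import Data.List.Membership.Propositional.Properties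
  using (∈-∃++; ∈-map⁺; ∈-concatMap⁺; ∈-tabulate⁺; ∈-tabulate⁻; ∈-allFin)
open import Data.List.Relation.Binary.Permutation.Propositional
  using (_↭_; ↭-refl; ↭-trans; prep)
open import Data.List.Relation.Binary.Permutation.Propositional.Properties
  using (↭-length; shift; filter-↭; ∈-resp-↭)
open import Relation.Nullary using (¬_)
open import Relation.Binary.PropositionalEquality

-- Numbering of the blocks

data Cycle : Set where
  outer inner : Cycle

-- A three-way comparison by structural recursion instead of a decision procedure: when the gap
-- between the two numbers is an explicit offset, each outcome is a short induction.
by-order : ∀ {A : Set} → A → A → A → ℕ → ℕ → A
by-order x y z zero    zero    = y
by-order x y z zero    (suc n) = x
by-order x y z (suc m) zero    = z
by-order x y z (suc m) (suc n) = by-order x y z m n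

by-order-< : ∀ {A : Set} {x y z : A} m o → by-order x y z m (suc (m + o)) ≡ x
by-order-< zero    o = refl
by-order-< (suc m) o = by-order-< m o

by-order-≡ : ∀ {A : Set} {x y z : A} m → by-order x y z m m ≡ y
by-order-≡ zero    = refl
by-order-≡ (suc m) = by-order-≡ m

by-order-> : ∀ {A : Set} {x y z : A} n o → by-order x y z (suc (n + o)) n ≡ z
by-order-> zero    o = refl
by-order-> (suc n) o = by-order-> n o

-- With `t = ⌊k/2⌋` the inner numbers start at `2t + 1`, which is `k` for odd `k` and `k + 1` for
-- even `k`, so they lie past all outer ones.
lowLabel : ℕ → Cycle → ℕ → ℕ
lowLabel t outer j = j
lowLabel t inner j = suc (t + t) + j

-- The second argument q is 2 (k - t).
highLabel : ℕ → ℕ → Cycle → ℕ → ℕ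
highLabel t q outer j = by-order j (suc j) (suc j) j t
highLabel t q inner j = by-order (suc (q + j)) t (q + j) (suc j) t

-- The number d only witnesses the inequality it is added to; close is the edge back to position 0.
data Covered (k t q r : ℕ) : Set where
  up    : ∀ κ j d → suc j + d ≡ k →
          r + suc (lowLabel t κ j + highLabel t q κ j) ≡ 4 * k → Covered k t q r
  down  : ∀ κ j d → suc (suc j) + d ≡ k →
          lowLabel t κ (suc j) + highLabel t q κ j ≡ r → Covered k t q r
  close : ∀ κ j → suc j ≡ k →
          lowLabel t κ 0 + highLabel t q κ j ≡ r → Covered k t q r

highOuter< : ∀ q j o → highLabel (suc (j + o)) q outer j ≡ j
highOuter< q j o = by-order-< j o

highOuter≥ : ∀ t q o → highLabel t q outer (t + o) ≡ suc (t + o)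
highOuter≥ t q zero rewrite +-identityʳ t = by-order-≡ t
highOuter≥ t q (suc o) rewrite +-suc t o = by-order-> t o

highInner< : ∀ q j o → highLabel (suc (suc (j + o))) q inner j ≡ suc (q + j)
highInner< q j o = by-order-< j o

highInner≡ : ∀ q j → highLabel (suc j) q inner j ≡ suc j
highInner≡ q j = by-order-≡ j

highInner≥ : ∀ t q o → highLabel t q inner (t + o) ≡ q + (t + o)
highInner≥ t q o = by-order-> t o

-- Edges sorted by position relative to `t`

module _ {k q r : ℕ} where

  private
    module _ {t h : ℕ} where
      by-up : ∀ κ j d → highLabel t q κ j ≡ h → suc j + d ≡ k →
        r + suc (lowLabel t κ j + h) ≡ 4 * k → Covered k t q r
      by-up κ j d refl = up κ j d

      by-down : ∀ κ j d → highLabel t q κ j ≡ h → suc (suc j) + d ≡ k →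
        lowLabel t κ (suc j) + h ≡ r → Covered k t q r
      by-down κ j d refl = down κ j d

      by-close : ∀ κ j → highLabel t q κ j ≡ h → suc j ≡ k →
        lowLabel t κ 0 + h ≡ r → Covered k t q r
      by-close κ j refl = close κ j

  -- This and the following lemmas evaluate `highLabel` on one side of `t`, so that the remaining
  -- hypotheses are semiring identities within reach of the ring solver.
  up-outer< : ∀ j o d → suc j + d ≡ k →
    r + suc (j + j) ≡ 4 * k → Covered k (suc (j + o)) q r
  up-outer< j o d e = by-up outer j d (highOuter< q j o) e

  up-outer≥ : ∀ t o d → suc (t + o) + d ≡ k →
    r + suc ((t + o) + suc (t + o)) ≡ 4 * k → Covered k t q r
  up-outer≥ t o d e = by-up outer (t + o) d (highOuter≥ t q o) e

  up-inner< : ∀ j o d → suc j + d ≡ k → let t = suc (suc (j + o)) in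
    r + suc ((suc (t + t) + j) + suc (q + j)) ≡ 4 * k → Covered k t q r
  up-inner< j o d e = by-up inner j d (highInner< q j o) e

  up-inner≡ : ∀ j d → suc j + d ≡ k → let t = suc j in
    r + suc ((suc (t + t) + j) + t) ≡ 4 * k → Covered k t q r
  up-inner≡ j d e = by-up inner j d (highInner≡ q j) e

  up-inner≥ : ∀ t o d → suc (t + o) + d ≡ k →
    r + suc ((suc (t + t) + (t + o)) + (q + (t + o))) ≡ 4 * k → Covered k t q r
  up-inner≥ t o d e = by-up inner (t + o) d (highInner≥ t q o) e

  down-outer< : ∀ j o d → suc (suc j) + d ≡ k →
    suc j + j ≡ r → Covered k (suc (j + o)) q r
  down-outer< j o d e = by-down outer j d (highOuter< q j o) e

  down-outer≥ : ∀ t o d → suc (suc (t + o)) + d ≡ k →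
    suc (t + o) + suc (t + o) ≡ r → Covered k t q r
  down-outer≥ t o d e = by-down outer (t + o) d (highOuter≥ t q o) e

  down-inner< : ∀ j o d → suc (suc j) + d ≡ k → let t = suc (suc (j + o)) in
    (suc (t + t) + suc j) + suc (q + j) ≡ r → Covered k t q r
  down-inner< j o d e = by-down inner j d (highInner< q j o) e

  down-inner≡ : ∀ j d → suc (suc j) + d ≡ k → let t = suc j in
    (suc (t + t) + suc j) + t ≡ r → Covered k t q r
  down-inner≡ j d e = by-down inner j d (highInner≡ q j) e

  down-inner≥ : ∀ t o d → suc (suc (t + o)) + d ≡ k →
    (suc (t + t) + suc (t + o)) + (q + (t + o)) ≡ r → Covered k t q r
  down-inner≥ t o d e = by-down inner (t + o) d (highInner≥ t q o) e

  close-outer : ∀ t o → suc (t + o) ≡ k → suc (t + o) ≡ r → Covered k t q r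
  close-outer t o e = by-close outer (t + o) (highOuter≥ t q o) e

  close-inner : ∀ t o → suc (t + o) ≡ k →
    (suc (t + t) + 0) + (q + (t + o)) ≡ r → Covered k t q r
  close-inner t o e = by-close inner (t + o) (highInner≥ t q o) e

-- i < a is spelled suc (i + o) ≡ a so that matching on refl leaves ring identities in i and o.
Segment : ℕ → (ℕ → Set) → Set
Segment a P = ∀ i o → suc (i + o) ≡ a → P i

single : ∀ {P : ℕ → Set} → P 0 → Segment 1 P
single p zero o eq = p

infixr 5 [_]_⨾_
[_]_⨾_ : ∀ a {b P} → Segment a P → Segment b (λ i → P (a + i)) → Segment (a + b) P
([ zero  ] s ⨾ s′) i o eq = s′ i o eq
([ suc a ] s ⨾ s′) zero o eq = s 0 a refl
([_]_⨾_ (suc a) {b} {P} s s′) (suc i) o eq =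
  ([_]_⨾_ a {b} {λ x → P (suc x)} (λ i o e → s (suc i) o (cong suc e)) s′) i o (suc-injective eq)

-- The cases `k = 2t` and `k = 2t + 1`, with `q = 2 (k - t)`. Apart from the closing edges, an edge
-- leaving position `j` of either cycle has an odd number if `j < t` and an even one if `j ≥ t`; the
-- closing edges have `k` and `3k`. Even and odd numbers are therefore covered separately.
Even Odd : ℕ → ℕ → Set
Even t = Covered (t + t) t (t + t)
Odd t = Covered (suc (t + t)) t (suc (suc (t + t)))

-- The range of x splits into runs, each served by one family of edges; the runs of length 1 come from
-- the closing edges and from the two edges at the inner high block numbered t.
even-evens : ∀ u → let t = suc u in
  Segment (t + (1 + (u + (t + (1 + u))))) (λ x → Even t (x + x))
even-evens u =
  [ suc u ] (λ { i o refl → s₁ i o }) ⨾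
  [ 1 ] single s₂ ⨾
  [ u ] (λ { i o refl → s₃ i o }) ⨾
  [ suc u ] (λ { i o refl → s₄ i o }) ⨾
  [ 1 ] single s₅ ⨾
  (λ { i o refl → s₆ i o })
  where
  s₁ : ∀ i o → Even (suc (i + o)) (i + i)
  s₁ i o = up-inner≥ (suc (i + o)) o i (solve (i ∷ o ∷ [])) (solve (i ∷ o ∷ []))
  -- The closing edges sit at `k` here and at `3k` in `s₅`, both even since `k` is.
  s₂ : let t = suc u ; x = t + 0 in Even t (x + x)
  s₂ = close-outer (suc u) u (solve (u ∷ [])) (solve (u ∷ []))
  s₃ : ∀ i o → let t = suc (suc (i + o)) ; x = t + (1 + i) in Even t (x + x)
  s₃ i o = down-outer≥ (suc (suc (i + o))) i o (solve (i ∷ o ∷ [])) (solve (i ∷ o ∷ []))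
  s₄ : ∀ i o → let u = i + o ; t = suc u ; x = t + (1 + (u + i)) in Even t (x + x)
  s₄ i o = up-outer≥ (suc (i + o)) o i (solve (i ∷ o ∷ [])) (solve (i ∷ o ∷ []))
  s₅ : let t = suc u ; x = t + (1 + (u + (t + 0))) in Even t (x + x)
  s₅ = close-inner (suc u) u (solve (u ∷ [])) (solve (u ∷ []))
  s₆ : ∀ i o → let u = suc (i + o) ; t = suc u ; x = t + (1 + (u + (t + (1 + i)))) in Even t (x + x)
  s₆ i o = down-inner≥ (suc (suc (i + o))) i o (solve (i ∷ o ∷ [])) (solve (i ∷ o ∷ []))

-- Every edge here leaves a position below `t`. The two runs of length 1 are the edges into and out
-- of the inner high block numbered `t`; they supply the middle values `2k - 1` and `2k + 1`.
even-odds : ∀ u → let t = suc u in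
  Segment (t + (u + (1 + (1 + (u + t))))) (λ x → Even t (suc (x + x)))
even-odds u =
  [ suc u ] (λ { i o refl → s₁ i o }) ⨾
  [ u ] (λ { i o refl → s₂ i o }) ⨾
  [ 1 ] single s₃ ⨾
  [ 1 ] single s₄ ⨾
  [ u ] (λ { i o refl → s₅ i o }) ⨾
  (λ { i o refl → s₆ i o })
  where
  s₁ : ∀ i o → Even (suc (i + o)) (suc (i + i))
  s₁ i o = down-outer< i o (i + (o + o)) (solve (i ∷ o ∷ [])) (solve (i ∷ o ∷ []))
  s₂ : ∀ i o → let t = suc (suc (i + o)) ; x = t + i in Even t (suc (x + x))
  -- Numbers of low-to-high edges fall as the position grows, so the position is the complement `o`
  -- of the run index `i`, and `t` has to be read with `o + i` in place of `i + o`.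
  s₂ i o rewrite +-comm i o =
    up-inner< o i (suc (suc (suc (i + i + o)))) (solve (i ∷ o ∷ [])) (solve (i ∷ o ∷ []))
  s₃ : let t = suc u ; x = t + (u + 0) in Even t (suc (x + x))
  s₃ = up-inner≡ u (suc u) refl (solve (u ∷ []))
  s₄ : let t = suc u ; x = t + (u + (1 + 0)) in Even t (suc (x + x))
  s₄ = down-inner≡ u u (solve (u ∷ [])) (solve (u ∷ []))
  s₅ : ∀ i o → let u = suc (i + o) ; t = suc u ; x = t + (u + (1 + (1 + i))) in Even t (suc (x + x))
  s₅ i o = down-inner< i o (suc (suc (i + (o + o)))) (solve (i ∷ o ∷ [])) (solve (i ∷ o ∷ []))
  s₆ : ∀ i o → let u = i + o ; t = suc u ; x = t + (u + (1 + (1 + (u + i)))) in Even t (suc (x + x))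
  s₆ i o rewrite +-comm i o =
    up-outer< o i (suc (i + i + o)) (solve (i ∷ o ∷ [])) (solve (i ∷ o ∷ []))

-- For odd `k` the closing numbers `k` and `3k` are odd. What remains in each cycle is `t + 1` edges
-- going up and `t` going down, all from positions `t` onward.
odd-evens : ∀ t → Segment (suc t + (t + (suc t + t))) (λ x → Odd t (x + x))
odd-evens t =
  [ suc t ] (λ { i o refl → s₁ i o }) ⨾
  [ t ] (λ { i o refl → s₂ i o }) ⨾
  [ suc t ] (λ { i o refl → s₃ i o }) ⨾
  (λ { i o refl → s₄ i o })
  where
  s₁ : ∀ i o → Odd (i + o) (i + i)
  s₁ i o = up-inner≥ (i + o) o i (solve (i ∷ o ∷ [])) (solve (i ∷ o ∷ []))
  s₂ : ∀ i o → let t = suc (i + o) ; x = suc t + i in Odd t (x + x)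
  s₂ i o = down-outer≥ (suc (i + o)) i o (solve (i ∷ o ∷ [])) (solve (i ∷ o ∷ []))
  s₃ : ∀ i o → let t = i + o ; x = suc t + (t + i) in Odd t (x + x)
  s₃ i o = up-outer≥ (i + o) o i (solve (i ∷ o ∷ [])) (solve (i ∷ o ∷ []))
  s₄ : ∀ i o → let t = suc (i + o) ; x = suc t + (t + (suc t + i)) in Odd t (x + x)
  s₄ i o = down-inner≥ (suc (i + o)) i o (solve (i ∷ o ∷ [])) (solve (i ∷ o ∷ []))

-- The closing edges contribute `k` and `3k`. The edges at the inner high block `t` again give
-- `2k - 1` and `2k + 1`, but now the outgoing edge has the smaller number.
odd-odds : ∀ u → let t = suc u in
  Segment (t + (1 + (u + (1 + (1 + (u + (1 + t))))))) (λ x → Odd t (suc (x + x)))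
odd-odds u =
  [ suc u ] (λ { i o refl → s₁ i o }) ⨾
  [ 1 ] single s₂ ⨾
  [ u ] (λ { i o refl → s₃ i o }) ⨾
  [ 1 ] single s₄ ⨾
  [ 1 ] single s₅ ⨾
  [ u ] (λ { i o refl → s₆ i o }) ⨾
  [ 1 ] single s₇ ⨾
  (λ { i o refl → s₈ i o })
  where
  s₁ : ∀ i o → Odd (suc (i + o)) (suc (i + i))
  s₁ i o = down-outer< i o (suc (i + (o + o))) (solve (i ∷ o ∷ [])) (solve (i ∷ o ∷ []))
  s₂ : let t = suc u ; x = t + 0 in Odd t (suc (x + x))
  s₂ = close-outer (suc u) (suc u) refl (solve (u ∷ []))
  s₃ : ∀ i o → let t = suc (suc (i + o)) ; x = t + (1 + i) in Odd t (suc (x + x))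
  s₃ i o rewrite +-comm i o =
    up-inner< o i (suc (suc (suc (suc (i + i + o))))) (solve (i ∷ o ∷ [])) (solve (i ∷ o ∷ []))
  s₄ : let t = suc u ; x = t + (1 + (u + 0)) in Odd t (suc (x + x))
  s₄ = down-inner≡ u (suc u) (solve (u ∷ [])) (solve (u ∷ []))
  s₅ : let t = suc u ; x = t + (1 + (u + (1 + 0))) in Odd t (suc (x + x))
  s₅ = up-inner≡ u (suc (suc u)) (solve (u ∷ [])) (solve (u ∷ []))
  s₆ : ∀ i o → let u = suc (i + o) ; t = suc u ; x = t + (1 + (u + (1 + (1 + i)))) in Odd t (suc (x + x))
  s₆ i o = down-inner< i o (suc (suc (suc (i + (o + o))))) (solve (i ∷ o ∷ [])) (solve (i ∷ o ∷ []))
  s₇ : let t = suc u ; x = t + (1 + (u + (1 + (1 + (u + 0))))) in Odd t (suc (x + x))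
  s₇ = close-inner (suc u) (suc u) refl (solve (u ∷ []))
  s₈ : ∀ i o → let u = i + o ; t = suc u ; x = t + (1 + (u + (1 + (1 + (u + (1 + i)))))) in Odd t (suc (x + x))
  s₈ i o rewrite +-comm i o =
    up-outer< o i (suc (suc (i + i + o))) (solve (i ∷ o ∷ [])) (solve (i ∷ o ∷ []))

-- For `k = 1` no position lies below `t = 0`, so the numbers 1 and 3 come from the closing edges
-- alone.
odd-odds-zero : Segment 2 (λ x → Odd 0 (suc (x + x)))
odd-odds-zero = [ 1 ] single (close-outer 0 0 refl refl) ⨾ single (close-inner 0 0 refl refl)

-- Combining even and odd block numbers

data Parity : ℕ → Set where
  even : ∀ x → Parity (x + x)
  odd  : ∀ x → Parity (suc (x + x))

parity : ∀ n → Parity n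
parity zero = even 0
parity (suc n) with parity n
... | even x = odd x
... | odd x  = subst Parity (cong suc (+-suc x x)) (even (suc x))

half< : ∀ x k → x + x < 4 * k → x < k + k
half< x k x+x<4k = ≰⇒> λ k+k≤x → <-irrefl refl (<-≤-trans x+x<4k
  (≤-trans (≤-reflexive (4k≡ k)) (+-mono-≤ k+k≤x k+k≤x)))
  where
  4k≡ : ∀ k → 4 * k ≡ (k + k) + (k + k)
  4k≡ = solve-∀

segment-at : ∀ {P a x} → Segment a P → x < a → P x
segment-at {x = x} s x<a with m≤n⇒∃[o]m+o≡n x<a
... | o , eq = s x o eq

by-parity : ∀ k {a b} {P : ℕ → Set} →
  Segment a (λ x → P (x + x)) → Segment b (λ x → P (suc (x + x))) →
  k + k ≡ a → k + k ≡ b → ∀ r → r < 4 * k → P r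
by-parity k se so refl refl r r<4k with parity r
... | even x = segment-at se (half< x k r<4k)
... | odd x  = segment-at so (half< x k (<-trans (n<1+n _) r<4k))

covered-even : ∀ u r → r < 4 * (suc u + suc u) → Even (suc u) r
covered-even u = by-parity (suc u + suc u) (even-evens u) (even-odds u) (solve (u ∷ [])) (solve (u ∷ []))

covered-odd : ∀ t r → r < 4 * suc (t + t) → Odd t r
covered-odd zero    = by-parity 1 (odd-evens 0) odd-odds-zero refl refl
covered-odd (suc u) =
  by-parity (suc (suc u + suc u)) (odd-evens (suc u)) (odd-odds u) (solve (u ∷ [])) (solve (u ∷ []))

-- Blocks and their differences

toℕ-mod : ∀ m n .{{_ : NonZero n}} → toℕ (m mod n) ≡ m % n
toℕ-mod m n = toℕ-fromℕ< (m%n<n m n)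

-- Modulo `N + 1`, `y` is `-(1 + Y)`, so the difference is `1 + x + Y`. That `g` is an element of
-- `Fin (suc N)` rules out any wrap-around.
⊖-low : ∀ {N} (x y g : Fin (suc N)) {Y} → toℕ y + Y ≡ N → toℕ g ≡ suc (toℕ x + Y) → x ⊖ y ≡ g
⊖-low {N} x y g {Y} y+Y≡N g≡ = toℕ-injective (begin
  toℕ (x ⊖ y)                              ≡⟨ toℕ-mod (toℕ x + (suc N ∸ toℕ y)) (suc N) ⟩
  (toℕ x + (suc N ∸ toℕ y)) % suc N        ≡⟨ cong (λ z → (toℕ x + z) % suc N) complement ⟩
  (toℕ x + suc Y) % suc N                  ≡⟨ cong (_% suc N) (trans (+-suc (toℕ x) Y) (sym g≡)) ⟩
  toℕ g % suc N                            ≡⟨ m<n⇒m%n≡m (toℕ<n g) ⟩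
  toℕ g                                    ∎)
  where
  open ≡-Reasoning
  complement : suc N ∸ toℕ y ≡ suc Y
  complement = trans (cong (_∸ toℕ y) (trans (cong suc (sym y+Y≡N)) (sym (+-suc (toℕ y) Y))))
                     (m+n∸m≡n (toℕ y) (suc Y))

-- Here `x` is `-(1 + X)`. The natural number reduced by `_⊖_` is `g` plus exactly one modulus.
⊖-high : ∀ {N} (x y g : Fin (suc N)) {X} → toℕ x + X ≡ N → X + toℕ y + toℕ g ≡ N → x ⊖ y ≡ g
⊖-high {N} x y g {X} x+X≡N X+y+g≡N = toℕ-injective (begin
  toℕ (x ⊖ y)                              ≡⟨ toℕ-mod (toℕ x + (suc N ∸ toℕ y)) (suc N) ⟩
  (toℕ x + (suc N ∸ toℕ y)) % suc N        ≡⟨ cong (λ z → (toℕ x + z) % suc N) complement ⟩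
  (toℕ x + suc (X + toℕ g)) % suc N        ≡⟨ cong (_% suc N) wrapped ⟩
  (toℕ g + suc N) % suc N                  ≡⟨ [m+n]%n≡m%n (toℕ g) (suc N) ⟩
  toℕ g % suc N                            ≡⟨ m<n⇒m%n≡m (toℕ<n g) ⟩
  toℕ g                                    ∎)
  where
  open ≡-Reasoning
  regroup₁ : ∀ a b c → suc (a + b + c) ≡ b + suc (a + c)
  regroup₁ = solve-∀
  regroup₂ : ∀ a b c → a + suc (b + c) ≡ c + suc (a + b)
  regroup₂ = solve-∀
  complement : suc N ∸ toℕ y ≡ suc (X + toℕ g)
  complement = trans (cong (_∸ toℕ y) (trans (cong suc (sym X+y+g≡N)) (regroup₁ X (toℕ y) (toℕ g))))
                     (m+n∸m≡n (toℕ y) (suc (X + toℕ g)))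
  wrapped : toℕ x + suc (X + toℕ g) ≡ toℕ g + suc N
  wrapped = trans (regroup₂ (toℕ x) X (toℕ g)) (cong (λ z → toℕ g + suc z) x+X≡N)

*+-mono-< : ∀ {a b i} l → a < b → i < l → a * l + i < b * l
*+-mono-< {a} {b} {i} l a<b i<l = begin-strict
  a * l + i   <⟨ +-monoʳ-< (a * l) i<l ⟩
  a * l + l   ≡⟨ +-comm (a * l) l ⟩
  suc a * l   ≤⟨ *-monoˡ-≤ l a<b ⟩
  b * l       ∎
  where open ≤-Reasoning

digits-unique : ∀ {l} a b (i j : Fin l) → a * l + toℕ i ≡ b * l + toℕ j → a ≡ b × i ≡ j
digits-unique zero zero i j e = refl , toℕ-injective e
digits-unique {l} zero (suc b) i j e =
  ⊥-elim (<⇒≢ (<-≤-trans (toℕ<n i) (≤-trans (m≤m+n l (b * l)) (m≤m+n (l + b * l) (toℕ j)))) e)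
digits-unique {l} (suc a) zero i j e =
  ⊥-elim (>⇒≢ (<-≤-trans (toℕ<n j) (≤-trans (m≤m+n l (a * l)) (m≤m+n (l + a * l) (toℕ i)))) e)
digits-unique {l} (suc a) (suc b) i j e with digits-unique a b i j
  (+-cancelˡ-≡ l _ _ (trans (sym (+-assoc l (a * l) (toℕ i))) (trans e (+-assoc l (b * l) (toℕ j)))))
... | refl , i≡j = refl , i≡j

last-digit : ∀ n l .{{_ : NonZero l}} → (n / l) * l + toℕ (n mod l) ≡ n
last-digit n l = trans (cong ((n / l) * l +_) (toℕ-mod n l))
  (trans (+-comm ((n / l) * l) (n % l)) (sym (m≡m%n+[m/n]*n n l)))

toℕ+toℕ-opposite : ∀ {n} (i : Fin (suc n)) → toℕ (opposite i) + toℕ i ≡ n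
toℕ+toℕ-opposite i = trans (cong (_+ toℕ i) (opposite-prop i)) (m∸n+n≡m (toℕ≤pred[n] i))

data Label : Set where
  low high : ℕ → Label

module Blowup (M l-1 : ℕ) where
  l N : ℕ
  l = suc l-1
  N = M * l * l

  -- `opposite` sends `x` to `N - x`, which is `-(1 + x)` modulo `N + 1`; this supplies the shift by
  -- 1 in the high blocks.
  element : Label → Fin l → Fin (suc N)
  element (low f)  i = (f * l * l + toℕ i) mod suc N
  element (high c) j = opposite (((c * l + toℕ j) * l) mod suc N)

  toℕ-low : ∀ {f} → f < M → ∀ i → toℕ (element (low f) i) ≡ f * l * l + toℕ i
  toℕ-low {f} f<M i = trans (toℕ-mod (f * l * l + toℕ i) (suc N)) (m<n⇒m%n≡m
    (m<n⇒m<1+n (*+-mono-< l (*-monoˡ-< l f<M) (toℕ<n i))))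

  toℕ-high : ∀ {c} → c < M → ∀ j → toℕ (element (high c) j) + (c * l + toℕ j) * l ≡ N
  toℕ-high {c} c<M j = trans (cong (toℕ (element (high c) j) +_) (sym reduced))
    (toℕ+toℕ-opposite (((c * l + toℕ j) * l) mod suc N))
    where
    reduced : toℕ (((c * l + toℕ j) * l) mod suc N) ≡ (c * l + toℕ j) * l
    reduced = trans (toℕ-mod ((c * l + toℕ j) * l) (suc N)) (m<n⇒m%n≡m
      (s≤s (*-monoˡ-≤ l (<⇒≤ (*+-mono-< l c<M (toℕ<n j))))))

  -- The right side is a base `l` expansion with leading part `f + c`: high blocks vary the middle
  -- digit `j`, low blocks the last digit `i`.
  offset-sum : ∀ f c i j → f * l * l + i + (c * l + j) * l ≡ ((f + c) * l + j) * l + i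
  offset-sum f c i j = lemma f c i j l
    where
    lemma : ∀ f c i j l → f * l * l + i + (c * l + j) * l ≡ ((f + c) * l + j) * l + i
    lemma = solve-∀

  -- A common element would make the sum in `offset-sum` equal to `N`, but an expansion with leading
  -- part below `M` stays below `M * l * l`.
  low≢high : ∀ f c → f + c < M → ∀ i j → element (low f) i ≢ element (high c) j
  low≢high f c f+c<M i j e = <⇒≢
    (*+-mono-< l (*+-mono-< l f+c<M (toℕ<n j)) (toℕ<n i)) (begin
      ((f + c) * l + toℕ j) * l + toℕ i              ≡⟨ offset-sum f c (toℕ i) (toℕ j) ⟨
      f * l * l + toℕ i + (c * l + toℕ j) * l        ≡⟨ cong (_+ (c * l + toℕ j) * l) (toℕ-low f<M i) ⟨
      toℕ (element (low f) i) + (c * l + toℕ j) * l  ≡⟨ cong (λ x → toℕ x + (c * l + toℕ j) * l) e ⟩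
      toℕ (element (high c) j) + (c * l + toℕ j) * l ≡⟨ toℕ-high c<M j ⟩
      N                                              ∎)
    where
    open ≡-Reasoning
    f<M : f < M
    f<M = ≤-<-trans (m≤m+n f c) f+c<M
    c<M : c < M
    c<M = ≤-<-trans (m≤n+m c f) f+c<M

  low-injective : ∀ f f′ → f < M → f′ < M → ∀ i i′ →
    element (low f) i ≡ element (low f′) i′ → f ≡ f′ × i ≡ i′
  low-injective f f′ p p′ i i′ e with digits-unique (f * l) (f′ * l) i i′
    (trans (sym (toℕ-low p i)) (trans (cong toℕ e) (toℕ-low p′ i′)))
  ... | fl≡f′l , i≡i′ = *-cancelʳ-≡ f f′ l fl≡f′l , i≡i′

  high-injective : ∀ c c′ → c < M → c′ < M → ∀ j j′ →
    element (high c) j ≡ element (high c′) j′ → c ≡ c′ × j ≡ j′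
  high-injective c c′ p p′ j j′ e = digits-unique c c′ j j′
    (*-cancelʳ-≡ _ _ l (+-cancelˡ-≡ (toℕ (element (high c) j)) _ _
      (trans (toℕ-high p j) (trans (sym (toℕ-high p′ j′)) (cong (λ x → toℕ x + _) (sym e))))))

  module _ f c (f+c<M : f + c < M) where
    private
      f<M : f < M
      f<M = ≤-<-trans (m≤m+n f c) f+c<M
      c<M : c < M
      c<M = ≤-<-trans (m≤n+m c f) f+c<M

    low⊖high : ∀ {g} i j → toℕ g ≡ suc (((f + c) * l + toℕ j) * l + toℕ i) →
      element (low f) i ⊖ element (high c) j ≡ g
    low⊖high {g} i j g≡ = ⊖-low (element (low f) i) (element (high c) j) g (toℕ-high c<M j)
      (trans g≡ (cong suc (sym (trans (cong (_+ (c * l + toℕ j) * l) (toℕ-low f<M i))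
                                      (offset-sum f c (toℕ i) (toℕ j))))))

    -- Negation runs through a block backwards, so both digits are complemented by `opposite`.
    high⊖low : ∀ {r g} i j → r + suc (f + c) ≡ M → toℕ g ≡ suc ((r * l + toℕ j) * l + toℕ i) →
      element (high c) (opposite j) ⊖ element (low f) (opposite i) ≡ g
    high⊖low {r} {g} i j r+1+f+c≡M g≡ =
      ⊖-high (element (high c) (opposite j)) (element (low f) (opposite i)) g (toℕ-high c<M (opposite j)) (begin
      (c * l + j̄) * l + toℕ (element (low f) (opposite i)) + toℕ g
        ≡⟨ cong₂ (λ x y → (c * l + j̄) * l + x + y) (toℕ-low f<M (opposite i)) g≡ ⟩
      (c * l + j̄) * l + (f * l * l + ī) + suc ((r * l + toℕ j) * l + toℕ i)
        ≡⟨ regroup f c r ī (toℕ i) j̄ (toℕ j) l ⟩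
      ((r + (f + c)) * l + (j̄ + toℕ j)) * l + suc (ī + toℕ i)
        ≡⟨ cong₂ (λ x y → ((r + (f + c)) * l + x) * l + suc y) (toℕ+toℕ-opposite j) (toℕ+toℕ-opposite i) ⟩
      ((r + (f + c)) * l + l-1) * l + suc l-1
        -- Complementary digits add up to `l - 1`; the extra 1 carries through both places.
        ≡⟨ carry (r + (f + c)) l-1 ⟩
      suc (r + (f + c)) * l * l
        ≡⟨ cong (λ x → x * l * l) (trans (sym (+-suc r (f + c))) r+1+f+c≡M) ⟩
      N ∎)
      where
      open ≡-Reasoning
      ī j̄ : ℕ
      ī = toℕ (opposite i)
      j̄ = toℕ (opposite j)
      regroup : ∀ f c r i i′ j j′ l →
        (c * l + j) * l + (f * l * l + i) + suc ((r * l + j′) * l + i′)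
        ≡ ((r + (f + c)) * l + (j + j′)) * l + suc (i + i′)
      regroup = solve-∀
      carry : ∀ s m → (s * suc m + m) * suc m + suc m ≡ suc s * suc m * suc m
      carry = solve-∀

-- Covering by exactly as many differences as there are nonzero elements

length-concatMap : ∀ {A B : Set} (f : A → List B) {n} → (∀ x → length (f x) ≡ n) →
  ∀ xs → length (concatMap f xs) ≡ length xs * n
length-concatMap f h []       = refl
length-concatMap f h (x ∷ xs) = trans (length-++ (f x)) (cong₂ _+_ (h x) (length-concatMap f h xs))

module _ {A : Set} where

  -- Each element of `ys` is removed from `xs` once. The rest of `ys` stays covered because it does
  -- not contain the removed element, and equal lengths leave nothing over in `xs`.
  unique-covering-↭ : ∀ {xs ys : List A} → Unique ys → (∀ {y} → y ∈ ys → y ∈ xs) →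
    length xs ≡ length ys → xs ↭ ys
  unique-covering-↭ {[]} {[]} [] sub eq = ↭-refl
  unique-covering-↭ {xs} {y ∷ ys} (y∉ys ∷ uys) sub eq with ∈-∃++ (sub (here refl))
  ... | as , bs , refl = ↭-trans (shift y as bs) (prep y (unique-covering-↭ uys sub′
          (suc-injective (trans (sym (↭-length (shift y as bs))) eq))))
    where
    sub′ : ∀ {z} → z ∈ ys → z ∈ as ++ bs
    sub′ z∈ys with ∈-resp-↭ (shift y as bs) (sub (there z∈ys))
    ... | here refl = ⊥-elim (All.lookup y∉ys z∈ys refl)
    ... | there z∈  = z∈

mult-∉ : ∀ {n} {x : Fin n} {xs} → x ∉ xs → mult x xs ≡ 0
mult-∉ {x = x} x∉xs = cong length (filter-none (x ≟_) (¬Any⇒All¬ _ x∉xs))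

mult-∈ : ∀ {n} {x : Fin n} {xs} → Unique xs → x ∈ xs → mult x xs ≡ 1
mult-∈ {x = x} (x∉xs ∷ _) (here refl) =
  trans (cong length (filter-accept (x ≟_) refl)) (cong suc (mult-∉ (All¬⇒¬Any x∉xs)))
mult-∈ {x = x} (y∉xs ∷ uxs) (there x∈xs) =
  trans (cong length (filter-reject (x ≟_) (λ { refl → All.lookup y∉xs x∈xs refl }))) (mult-∈ uxs x∈xs)

module _ {N} {xs : List (Fin (suc N))} (length≡N : length xs ≡ N)
         (covers : ∀ g → fsuc g ∈ xs) where
  private
    nonzero : List (Fin (suc N))
    nonzero = tabulate fsuc

    nonzero-unique : Unique nonzero
    nonzero-unique = tabulate⁺ fsuc-injective

    xs↭nonzero : xs ↭ nonzero
    xs↭nonzero = unique-covering-↭ nonzero-unique sub (trans length≡N (sym (length-tabulate fsuc)))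
      where
      sub : ∀ {y} → y ∈ nonzero → y ∈ xs
      sub y∈ with ∈-tabulate⁻ y∈
      ... | g , refl = covers g

    mult-nonzero : ∀ g → mult g xs ≡ mult g nonzero
    mult-nonzero g = ↭-length (filter-↭ (g ≟_) xs↭nonzero)

  mult-zero≡0 : mult fzero xs ≡ 0
  mult-zero≡0 = trans (mult-nonzero fzero) (mult-∉ zero∉)
    where
    zero∉ : fzero ∉ nonzero
    zero∉ z∈ with ∈-tabulate⁻ {f = fsuc} z∈
    ... | _ , ()

  mult-suc≡1 : ∀ g → mult (fsuc g) xs ≡ 1
  mult-suc≡1 g = trans (mult-nonzero (fsuc g)) (mult-∈ nonzero-unique (∈-tabulate⁺ g))

-- Size and members of the multiset of differences

module _ {n} .{{_ : NonZero n}} where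

  length-Δ : ∀ (A B : List (Fin n)) → length (Δ A B) ≡ length A * length B
  length-Δ A B = length-concatMap (λ a → map (a ⊖_) B) (λ a → length-map (a ⊖_) B) A

  ∈-Δ : ∀ {A B : List (Fin n)} {a b} → a ∈ A → b ∈ B → a ⊖ b ∈ Δ A B
  ∈-Δ {A} {B} a∈A b∈B = ∈-concatMap⁺ (λ a → map (a ⊖_) B) (lose a∈A (∈-map⁺ _ b∈B))

  length-ΔUnion : ∀ {m l} c (A : Fin m → List (Fin n)) → (∀ i → length (A i) ≡ l) →
    length (ΔUnion c A) ≡ m * (l * l)
  length-ΔUnion {m} {l} c A size =
    trans (length-concatMap (λ i → Δ (A (i +ₘ c)) (A i))
            (λ i → trans (length-Δ (A (i +ₘ c)) (A i)) (cong₂ _*_ (size (i +ₘ c)) (size i))) (allFin m))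
          (cong (_* (l * l)) (length-tabulate {n = m} (λ i → i)))

  ∈-ΔUnion : ∀ {m} c (A : Fin m → List (Fin n)) i {a b} → a ∈ A (i +ₘ c) → b ∈ A i → a ⊖ b ∈ ΔUnion c A
  ∈-ΔUnion c A i a∈ b∈ = ∈-concatMap⁺ (λ i → Δ (A (i +ₘ c)) (A i)) (lose (∈-allFin i) (∈-Δ a∈ b∈))

-- Positions modulo `4k` as vertices of two cycles

toℕ-+ₘ : ∀ {m} (i : Fin m) c {w} → w < m → toℕ i + c ≡ w ⊎ toℕ i + c ≡ w + m → toℕ (i +ₘ c) ≡ w
toℕ-+ₘ {suc m} i c {w} w<m e = trans (toℕ-mod (toℕ i + c) (suc m)) (reduce e)
  where
  reduce : toℕ i + c ≡ w ⊎ toℕ i + c ≡ w + suc m → (toℕ i + c) % suc m ≡ w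
  reduce (inj₁ e) = trans (cong (_% suc m) e) (m<n⇒m%n≡m w<m)
  reduce (inj₂ e) = trans (cong (_% suc m) e) (trans ([m+n]%n≡m%n w (suc m)) (m<n⇒m%n≡m w<m))

data Vertex : Set where
  lo hi : Cycle → ℕ → Vertex

-- The parity of a position selects the cycle, and its residue modulo 4 then tells low from high; a
-- step of 2 keeps the former and switches the latter.
place : Vertex → ℕ
place (lo outer j) = j * 4
place (lo inner j) = 1 + j * 4
place (hi outer j) = 2 + j * 4
place (hi inner j) = 3 + j * 4

next : Vertex → Vertex
next (lo κ j) = lo κ (suc j)
next (hi κ j) = hi κ (suc j)

vertex : ℕ → Vertex
vertex 0 = lo outer 0
vertex 1 = lo inner 0
vertex 2 = hi outer 0
vertex 3 = hi inner 0
vertex (suc (suc (suc (suc n)))) = next (vertex n)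

vertex-place : ∀ v → vertex (place v) ≡ v
vertex-place (lo outer zero)    = refl
vertex-place (lo inner zero)    = refl
vertex-place (hi outer zero)    = refl
vertex-place (hi inner zero)    = refl
vertex-place (lo outer (suc j)) = cong next (vertex-place (lo outer j))
vertex-place (lo inner (suc j)) = cong next (vertex-place (lo inner j))
vertex-place (hi outer (suc j)) = cong next (vertex-place (hi outer j))
vertex-place (hi inner (suc j)) = cong next (vertex-place (hi inner j))

place-next : ∀ v → place (next v) ≡ 4 + place v
place-next (lo outer j) = refl
place-next (lo inner j) = refl
place-next (hi outer j) = refl
place-next (hi inner j) = refl

place-vertex : ∀ n → place (vertex n) ≡ n
place-vertex 0 = refl
place-vertex 1 = refl
place-vertex 2 = refl
place-vertex 3 = refl
place-vertex (suc (suc (suc (suc n)))) = trans (place-next (vertex n)) (cong (4 +_) (place-vertex n))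

index : Vertex → ℕ
index (lo κ j) = j
index (hi κ j) = j

place-bounds : ∀ v → ∃ λ s → s < 4 × place v ≡ s + index v * 4
place-bounds (lo outer j) = 0 , s≤s z≤n , refl
place-bounds (lo inner j) = 1 , s≤s (s≤s z≤n) , refl
place-bounds (hi outer j) = 2 , s≤s (s≤s (s≤s z≤n)) , refl
place-bounds (hi inner j) = 3 , s≤s (s≤s (s≤s (s≤s z≤n))) , refl

place< : ∀ {k} v → index v < k → place v < 4 * k
place< {k} v i<k with place-bounds v
... | s , s<4 , e rewrite e | *-comm 4 k = ≤-trans (+-monoˡ-≤ (index v * 4) s<4) (*-monoˡ-≤ 4 i<k)

index< : ∀ {k} v → place v < 4 * k → index v < k
index< {k} v p with place-bounds v
... | s , s<4 , e rewrite e | *-comm 4 k = *-cancelʳ-< 4 _ _ (≤-<-trans (m≤n+m _ s) p)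

-- Bounds and distinctness of the block numbers

by-order-cases : ∀ {A : Set} {x y z : A} m n →
  (m < n × by-order x y z m n ≡ x) ⊎ (m ≡ n × by-order x y z m n ≡ y) ⊎ (n < m × by-order x y z m n ≡ z)
by-order-cases zero    zero    = inj₂ (inj₁ (refl , refl))
by-order-cases zero    (suc n) = inj₁ (z<s , refl)
by-order-cases (suc m) zero    = inj₂ (inj₂ (z<s , refl))
by-order-cases (suc m) (suc n) with by-order-cases m n
... | inj₁ (p , e)        = inj₁ (s≤s p , e)
... | inj₂ (inj₁ (p , e)) = inj₂ (inj₁ (cong suc p , e))
... | inj₂ (inj₂ (p , e)) = inj₂ (inj₂ (s≤s p , e))

highOuter-cases : ∀ t q j →
  (j < t × highLabel t q outer j ≡ j) ⊎ (t ≤ j × highLabel t q outer j ≡ suc j)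
highOuter-cases t q j with by-order-cases {x = j} {suc j} {suc j} j t
... | inj₁ p              = inj₁ p
... | inj₂ (inj₁ (p , e)) = inj₂ (≤-reflexive (sym p) , e)
... | inj₂ (inj₂ (p , e)) = inj₂ (<⇒≤ p , e)

highInner-cases : ∀ t q j →
  (suc j < t × highLabel t q inner j ≡ suc (q + j)) ⊎
  (suc j ≡ t × highLabel t q inner j ≡ t) ⊎
  (t ≤ j × highLabel t q inner j ≡ q + j)
highInner-cases t q j with by-order-cases {x = suc (q + j)} {t} {q + j} (suc j) t
... | inj₁ p              = inj₁ p
... | inj₂ (inj₁ p)       = inj₂ (inj₁ p)
... | inj₂ (inj₂ (p , e)) = inj₂ (inj₂ (s≤s⁻¹ p , e))

-- Given `q = 2k - 2t`, the condition `k ≤ q` says `2t ≤ k`. Together with `k ≤ 1 + 2t` it fixes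
-- `t = ⌊k/2⌋`, and `t < k` makes `k` positive.
module _ {k t q : ℕ} (t<k : t < k) (k≤1+2t : k ≤ suc (t + t)) (k≤q : k ≤ q)
         (q+2t≡2k : q + (t + t) ≡ k + k) where

  -- `q + t` is `2k - t`. Outer high numbers are at most `k`, hence below the inner ones from
  -- position `t` on.
  k<q+t : k < q + t
  k<q+t = +-cancelʳ-< t k (q + t) (≤-trans (+-monoʳ-< k t<k)
    (≤-reflexive (trans (sym q+2t≡2k) (sym (+-assoc q t t)))))

  t<q+ : ∀ {i} → t < q + i
  t<q+ = <-≤-trans t<k (≤-trans k≤q (m≤m+n q _))

  lowLabel-bound : ∀ κ {j} → j < k → lowLabel t κ j ≤ (t + t) + k
  lowLabel-bound outer     j<k = ≤-trans (<⇒≤ j<k) (m≤n+m k (t + t))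
  lowLabel-bound inner {j} j<k =
    ≤-trans (≤-reflexive (sym (+-suc (t + t) j))) (+-monoʳ-≤ (t + t) j<k)

  highLabel-bound : ∀ κ {j} → j < k → highLabel t q κ j < q + k
  highLabel-bound outer {j} j<k with highOuter-cases t q j
  ... | inj₁ (_ , e) rewrite e = ≤-trans j<k (m≤n+m k q)
  ... | inj₂ (_ , e) rewrite e = <-≤-trans (≤-<-trans j<k k<q+t) (+-monoʳ-≤ q (<⇒≤ t<k))
  highLabel-bound inner {j} j<k with highInner-cases t q j
  ... | inj₁ (p , e) rewrite e | sym (+-suc q j) = +-monoʳ-< q (<-trans p t<k)
  ... | inj₂ (inj₁ (_ , e)) rewrite e = ≤-trans t<k (m≤n+m k q)
  ... | inj₂ (inj₂ (_ , e)) rewrite e = +-monoʳ-< q j<k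

  -- The separate bounds `2t + k` and `q + k` add up to `4k`. Arbitrary pairs of a low and a high
  -- block are allowed, not only edges, because disjointness needs them all.
  labels-sum-bound : ∀ κ κ′ {j j′} → j < k → j′ < k →
    lowLabel t κ j + highLabel t q κ′ j′ < 4 * k
  labels-sum-bound κ κ′ j<k j′<k =
    <-≤-trans (+-mono-≤-< (lowLabel-bound κ j<k) (highLabel-bound κ′ j′<k)) (≤-reflexive (begin
      (t + t) + k + (q + k)   ≡⟨ regroup t k q ⟩
      q + (t + t) + (k + k)   ≡⟨ cong (_+ (k + k)) q+2t≡2k ⟩
      k + k + (k + k)         ≡⟨ four k ⟩
      4 * k                   ∎))
    where
    open ≡-Reasoning
    regroup : ∀ t k q → (t + t) + k + (q + k) ≡ q + (t + t) + (k + k)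
    regroup = solve-∀
    four : ∀ k → k + k + (k + k) ≡ 4 * k
    four = solve-∀

  lowLabel-injective : ∀ κ κ′ {j j′} → j < k → j′ < k →
    lowLabel t κ j ≡ lowLabel t κ′ j′ → κ ≡ κ′ × j ≡ j′
  lowLabel-injective outer outer p p′ e = refl , e
  lowLabel-injective inner inner p p′ e = refl , +-cancelˡ-≡ (suc (t + t)) _ _ e
  lowLabel-injective outer inner p p′ refl = ⊥-elim (<⇒≱ p (≤-trans k≤1+2t (m≤m+n _ _)))
  lowLabel-injective inner outer p p′ refl = ⊥-elim (<⇒≱ p′ (≤-trans k≤1+2t (m≤m+n _ _)))

  -- The inner number `t` falls into the gap left by the outer ones; every other inner number
  -- exceeds `k`, which bounds the outer ones.
  outer-high≢inner-high : ∀ {j j′} → j < k → highLabel t q outer j ≢ highLabel t q inner j′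
  outer-high≢inner-high {j} {j′} p e with highOuter-cases t q j | highInner-cases t q j′
  ... | inj₁ (_ , a) | inj₁ (_ , b) = ⊥-elim (<⇒≱ p (≤-trans k≤q (≤-trans (m≤m+n q j′)
          (≤-trans (n≤1+n _) (≤-reflexive (sym (trans (sym a) (trans e b))))))))
  ... | inj₁ (j<t , a) | inj₂ (inj₁ (_ , b)) = <-irrefl (trans (sym a) (trans e b)) j<t
  ... | inj₁ (_ , a) | inj₂ (inj₂ (_ , b)) = ⊥-elim (<⇒≱ p (≤-trans k≤q (≤-trans (m≤m+n q j′)
          (≤-reflexive (sym (trans (sym a) (trans e b)))))))
  ... | inj₂ (_ , a) | inj₁ (_ , b) = ⊥-elim (<⇒≱ p (≤-trans k≤q (≤-trans (m≤m+n q j′)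
          (≤-reflexive (sym (suc-injective (trans (sym a) (trans e b))))))))
  ... | inj₂ (t≤j , a) | inj₂ (inj₁ (_ , b)) = <-irrefl (sym (trans (sym a) (trans e b))) (s≤s t≤j)
  ... | inj₂ (_ , a) | inj₂ (inj₂ (t≤j′ , b)) = <-irrefl (trans (sym a) (trans e b))
          (<-≤-trans (≤-<-trans p k<q+t) (+-monoʳ-≤ q t≤j′))

  outer-high-injective : ∀ {j j′} → highLabel t q outer j ≡ highLabel t q outer j′ → j ≡ j′
  outer-high-injective {j} {j′} e with highOuter-cases t q j | highOuter-cases t q j′
  ... | inj₁ (_ , a) | inj₁ (_ , b) = trans (sym a) (trans e b)
  ... | inj₂ (_ , a) | inj₂ (_ , b) = suc-injective (trans (sym a) (trans e b))
  ... | inj₁ (j<t , a) | inj₂ (t≤j′ , b) =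
          ⊥-elim (<⇒≢ (<-≤-trans j<t (m≤n⇒m≤1+n t≤j′)) (trans (sym a) (trans e b)))
  ... | inj₂ (t≤j , a) | inj₁ (j′<t , b) =
          ⊥-elim (>⇒≢ (<-≤-trans j′<t (m≤n⇒m≤1+n t≤j)) (trans (sym a) (trans e b)))

  inner-high-injective : ∀ {j j′} → highLabel t q inner j ≡ highLabel t q inner j′ → j ≡ j′
  inner-high-injective {j} {j′} e with highInner-cases t q j | highInner-cases t q j′
  ... | inj₁ (_ , a) | inj₁ (_ , b) = +-cancelˡ-≡ (suc q) _ _ (trans (sym a) (trans e b))
  ... | inj₂ (inj₁ (a , _)) | inj₂ (inj₁ (b , _)) = suc-injective (trans a (sym b))
  ... | inj₂ (inj₂ (_ , a)) | inj₂ (inj₂ (_ , b)) = +-cancelˡ-≡ q _ _ (trans (sym a) (trans e b))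
  ... | inj₁ (_ , a) | inj₂ (inj₁ (_ , b)) = ⊥-elim (<⇒≢ (m<n⇒m<1+n t<q+) (trans (sym b) (trans (sym e) a)))
  ... | inj₂ (inj₁ (_ , a)) | inj₁ (_ , b) = ⊥-elim (<⇒≢ (m<n⇒m<1+n t<q+) (trans (sym a) (trans e b)))
  ... | inj₂ (inj₁ (_ , a)) | inj₂ (inj₂ (_ , b)) =
          ⊥-elim (<⇒≢ t<q+ (trans (sym a) (trans e b)))
  ... | inj₂ (inj₂ (_ , a)) | inj₂ (inj₁ (_ , b)) =
          ⊥-elim (<⇒≢ t<q+ (trans (sym b) (trans (sym e) a)))
  ... | inj₁ (1+j<t , a) | inj₂ (inj₂ (t≤j′ , b)) =
          ⊥-elim (<⇒≢ (<-≤-trans 1+j<t t≤j′) (+-cancelˡ-≡ q _ _ (trans (+-suc q j) (trans (sym a) (trans e b)))))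
  ... | inj₂ (inj₂ (t≤j , a)) | inj₁ (1+j′<t , b) =
          ⊥-elim (<⇒≢ (<-≤-trans 1+j′<t t≤j) (+-cancelˡ-≡ q _ _ (trans (+-suc q j′) (trans (sym b) (trans (sym e) a)))))

  highLabel-injective : ∀ κ κ′ {j j′} → j < k → j′ < k →
    highLabel t q κ j ≡ highLabel t q κ′ j′ → κ ≡ κ′ × j ≡ j′
  highLabel-injective outer outer _ _ e = refl , outer-high-injective e
  highLabel-injective inner inner _ _ e = refl , inner-high-injective e
  highLabel-injective outer inner p _ e = ⊥-elim (outer-high≢inner-high p e)
  highLabel-injective inner outer _ p e = ⊥-elim (outer-high≢inner-high p (sym e))

  -- The family of blocks and its differences

  module _ {l-1 : ℕ} (covered : ∀ r → r < 4 * k → Covered k t q r) where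
    open Blowup (4 * k) l-1

    label : Vertex → Label
    label (lo κ j) = low (lowLabel t κ j)
    label (hi κ j) = high (highLabel t q κ j)

    blown : Fin (4 * k) → List (Fin (suc N))
    blown v = tabulate (element (label (vertex (toℕ v))))

    element-injective : ∀ u v i j → index u < k → index v < k →
      element (label u) i ≡ element (label v) j → u ≡ v × i ≡ j
    element-injective (lo κ a) (lo κ′ b) i j p p′ e
      with low-injective (lowLabel t κ a) (lowLabel t κ′ b) (below κ p) (below κ′ p′) i j e
      where
      below : ∀ κ {a} → a < k → lowLabel t κ a < 4 * k
      below κ p = ≤-<-trans (m≤m+n _ _) (labels-sum-bound κ outer p p)
    ... | eq , i≡j with lowLabel-injective κ κ′ p p′ eq
    ...   | refl , refl = refl , i≡j
    element-injective (hi κ a) (hi κ′ b) i j p p′ e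
      with high-injective (highLabel t q κ a) (highLabel t q κ′ b) (below κ p) (below κ′ p′) i j e
      where
      below : ∀ κ {a} → a < k → highLabel t q κ a < 4 * k
      below κ p = ≤-<-trans (m≤n+m _ _) (labels-sum-bound outer κ p p)
    ... | eq , i≡j with highLabel-injective κ κ′ p p′ eq
    ...   | refl , refl = refl , i≡j
    element-injective (lo κ a) (hi κ′ b) i j p p′ e =
      ⊥-elim (low≢high (lowLabel t κ a) (highLabel t q κ′ b) (labels-sum-bound κ κ′ p p′) i j e)
    element-injective (hi κ a) (lo κ′ b) i j p p′ e =
      ⊥-elim (low≢high (lowLabel t κ′ b) (highLabel t q κ a) (labels-sum-bound κ′ κ p′ p) j i (sym e))

    index-vertex< : ∀ (v : Fin (4 * k)) → index (vertex (toℕ v)) < k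
    index-vertex< v = index< (vertex (toℕ v)) (subst (_< 4 * k) (sym (place-vertex (toℕ v))) (toℕ<n v))

    blown-unique : ∀ v → Unique (blown v)
    blown-unique v = tabulate⁺ {f = element (label u)} λ {i} {j} e →
      proj₂ (element-injective u u i j (index-vertex< v) (index-vertex< v) e)
      where
      u : Vertex
      u = vertex (toℕ v)

    blown-disjoint : ∀ u v → u ≢ v → ∀ x → x ∈ blown u → ¬ (x ∈ blown v)
    blown-disjoint u v u≢v x x∈u x∈v
      with ∈-tabulate⁻ {f = element (label (vertex (toℕ u)))} x∈u
         | ∈-tabulate⁻ {f = element (label (vertex (toℕ v)))} x∈v
    ... | i , x≡ | j , x≡′ = u≢v (toℕ-injective (begin
      toℕ u                    ≡⟨ place-vertex (toℕ u) ⟨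
      place (vertex (toℕ u))   ≡⟨ cong place (proj₁ (element-injective (vertex (toℕ u)) (vertex (toℕ v))
                                    i j (index-vertex< u) (index-vertex< v) (trans (sym x≡) x≡′))) ⟩
      place (vertex (toℕ v))   ≡⟨ place-vertex (toℕ v) ⟩
      toℕ v                    ∎))
      where open ≡-Reasoning

    blown-size : ∀ v → length (blown v) ≡ l
    blown-size v = length-tabulate (element (label (vertex (toℕ v))))

    element∈blown : ∀ u v → toℕ v ≡ place u → ∀ i → element (label u) i ∈ blown v
    element∈blown u v e i = subst (λ w → element (label w) i ∈ blown v)
      (trans (cong vertex e) (vertex-place u)) (∈-tabulate⁺ {f = element (label (vertex (toℕ v)))} i)

    difference∈ : ∀ u w → index u < k → index w < k →
      place u + 2 ≡ place w ⊎ place u + 2 ≡ place w + 4 * k → ∀ i j →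
      element (label w) i ⊖ element (label u) j ∈ ΔUnion 2 blown
    difference∈ u w u<k w<k step i j = ∈-ΔUnion 2 blown v
      (element∈blown w (v +ₘ 2) (toℕ-+ₘ v 2 (place< w w<k)
        (subst (λ z → z + 2 ≡ place w ⊎ z + 2 ≡ place w + 4 * k) (sym v≡) step)) i)
      (element∈blown u v v≡ j)
      where
      v : Fin (4 * k)
      v = fromℕ< (place< u u<k)
      v≡ : toℕ v ≡ place u
      v≡ = toℕ-fromℕ< (place< u u<k)

    up-step : ∀ κ j → place (lo κ j) + 2 ≡ place (hi κ j)
    up-step outer j = +-comm (j * 4) 2
    up-step inner j = +-comm (1 + j * 4) 2

    down-step : ∀ κ j → place (hi κ j) + 2 ≡ place (lo κ (suc j))
    down-step outer j = +-comm (2 + j * 4) 2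
    down-step inner j = +-comm (3 + j * 4) 2

    close-step : ∀ κ j → suc j ≡ k → place (hi κ j) + 2 ≡ place (lo κ 0) + 4 * k
    close-step outer j refl = trans (+-comm (2 + j * 4) 2) (*-comm (suc j) 4)
    close-step inner j refl = trans (+-comm (3 + j * 4) 2) (cong suc (*-comm (suc j) 4))

    nonzero∈ : ∀ g → fsuc g ∈ ΔUnion 2 blown
    nonzero∈ g = go (covered r (m<n*o⇒m/o<n (m<n*o⇒m/o<n (toℕ<n g))))
      where
      -- Base `l` expansion of `g`, which is the target element minus 1: `r` is the block number,
      -- `j` and `i` the digits inside the block.
      r : ℕ
      r = toℕ g / l / l
      i j : Fin l
      i = toℕ g mod l
      j = (toℕ g / l) mod l
      expansion : toℕ (fsuc g) ≡ suc ((r * l + toℕ j) * l + toℕ i)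
      expansion = cong suc (sym (trans (cong (λ x → x * l + toℕ i) (last-digit (toℕ g / l) l))
                                       (last-digit (toℕ g) l)))
      go : Covered k t q r → fsuc g ∈ ΔUnion 2 blown
      go (up κ a d e sum) = subst (_∈ ΔUnion 2 blown)
        (high⊖low _ (highLabel t q κ a) (labels-sum-bound κ κ a<k a<k) i j sum expansion)
        (difference∈ (lo κ a) (hi κ a) a<k a<k (inj₁ (up-step κ a)) (opposite j) (opposite i))
        where
        a<k : a < k
        a<k = m+n≤o⇒m≤o (suc a) (≤-reflexive e)
      go (down κ a d e sum) = subst (_∈ ΔUnion 2 blown)
        (low⊖high (lowLabel t κ (suc a)) _ (labels-sum-bound κ κ a′<k (<⇒≤ a′<k)) i j
          (trans expansion (cong (λ x → suc ((x * l + toℕ j) * l + toℕ i)) (sym sum))))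
        (difference∈ (hi κ a) (lo κ (suc a)) (<⇒≤ a′<k) a′<k (inj₁ (down-step κ a)) i j)
        where
        a′<k : suc a < k
        a′<k = m+n≤o⇒m≤o (suc (suc a)) (≤-reflexive e)
      -- The last high block of a cycle precedes position 0 of the same cycle once `4k` is
      -- subtracted.
      go (close κ a e sum) = subst (_∈ ΔUnion 2 blown)
        (low⊖high (lowLabel t κ 0) _ (labels-sum-bound κ κ 0<k a<k) i j
          (trans expansion (cong (λ x → suc ((x * l + toℕ j) * l + toℕ i)) (sym sum))))
        (difference∈ (hi κ a) (lo κ 0) a<k 0<k (inj₂ (close-step κ a e)) i j)
        where
        a<k : a < k
        a<k = ≤-reflexive e
        0<k : 0 < k
        0<k = ≤-<-trans z≤n a<k

    blown-isCEDF : IsCEDF (suc N) (4 * k) l 1 2 blown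
    blown-isCEDF = record
      { m>1         = ≤-trans (s≤s (s≤s z≤n)) 4≤4k
      ; c≥1         = s≤s z≤n
      ; c≤m-1       = ≤-trans (s≤s (s≤s (s≤s z≤n))) 4≤4k
      ; unique      = blown-unique
      ; size        = blown-size
      ; disjoint    = blown-disjoint
      ; zeroMult    = λ { fzero _ → mult-zero≡0 total nonzero∈ }
      ; nonzeroMult = λ { fzero z≢0 → ⊥-elim (z≢0 refl) ; (fsuc g) _ → mult-suc≡1 total nonzero∈ g }
      }
      where
      4≤4k : 4 ≤ 4 * k
      4≤4k = *-monoʳ-≤ 4 (≤-<-trans z≤n t<k)
      total : length (ΔUnion 2 blown) ≡ N
      total = trans (length-ΔUnion 2 blown blown-size) (sym (*-assoc (4 * k) l l))

-- Choice of `t` and `q` for the two parities of `k`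

theorem6p6 : (k l : ℕ) → 1 ≤ k → 1 ≤ l →
    Σ (Fin (4 * k) → List (Fin (suc (4 * k * l * l))))
    (λ A → IsCEDF (suc (4 * k * l * l)) (4 * k) l 1 2 A)
theorem6p6 k (suc l-1) 1≤k _ = by-cases (parity k) 1≤k
  where
  CEDF-exists : ℕ → Set
  CEDF-exists k = let l = suc l-1 in
    Σ (Fin (4 * k) → List (Fin (suc (4 * k * l * l)))) (IsCEDF (suc (4 * k * l * l)) (4 * k) l 1 2)
  by-cases : ∀ {k} → Parity k → 1 ≤ k → CEDF-exists k
  -- `k` is positive, so `t = k / 2` is a successor; here `q = 2 (k - t) = 2t`.
  by-cases (even (suc u)) _ = _ , blown-isCEDF {t = suc u} {q = suc u + suc u}
    (m<m+n (suc u) z<s) (n≤1+n _) ≤-refl refl (covered-even u)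
  -- `k = 2t + 1`, where `t` may be 0, and `q = 2 (k - t) = 2t + 2`.
  by-cases (odd t) _ = _ , blown-isCEDF {t = t} {q = suc (suc (t + t))}
    (s≤s (m≤m+n t t)) ≤-refl (n≤1+n _) (cong suc (sym (+-suc (t + t) (t + t)))) (covered-odd t)
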